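{- For all integers $m\ge n\ge 2$, $$\gamma^{SLD}(K_n\times K_m)=\begin{cases} m+n-1, & n>2,\\ m, & n=2,\ m>2,\\ 4, & n=m=2.\end{cases}$$
   Context: $K_q$ is the complete graph on vertex set $\{1,\dots,q\}$. The direct product $G_1\times G_2$ has vertex set $V_1\times V_2$, with $(u_1,u_2)$ adjacent to $(v_1,v_2)$ iff $u_1v_1\in E_1$ and $u_2v_2\in E_2$. For a code (nonempty vertex subset) $C$ and vertex $v$, $I(C;v)=N[v]\cap C$, where $N[v]$ is the closed neighbourhood. A code $C$ in a graph $G$ is self-locating-dominating if for every non-codeword $u$, $I(C;u)\ne\emptyset$ and $\bigcap_{c\in I(C;u)}N[c]=\{u\}$. $\gamma^{SLD}(G)$ is the minimum size of a self-locating-dominating code in the finite graph $G$. -}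

module Defs where

open import Level using (0ℓ)
open import Data.Fin.Base using (Fin)
open import Data.List.Base using (List; []; length)
import Data.List.Membership.Propositional as List
open import Data.List.Relation.Unary.Unique.Propositional using (Unique)
open import Data.Nat.Base using (ℕ; _≤_)
open import Data.Nat.Properties using (≤-antisym)
open import Data.Product.Base using (∃; _×_; _,_)
open import Data.Sum.Base using (_⊎_)
open import Relation.Binary.Core using (Rel)
open import Relation.Binary.Definitions using (Irreflexive; Symmetric)
open import Relation.Binary.PropositionalEquality
  using (_≡_; _≢_; refl; ≢-sym)
open import Relation.Unary
  using (Pred; _∈_; _∉_; _∩_; _≐_; ｛_｝; ⋂; Satisfiable)

record Graph : Set₁ where
  infix 4 _~_
  field
    Vertex   : Set
    _~_      : Rel Vertex 0ℓ
    ~-sym    : Symmetric _~_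
    ~-irrefl : Irreflexive _≡_ _~_

K : ℕ → Graph
K q = record
  { Vertex   = Fin q
  ; _~_      = _≢_
  ; ~-sym    = ≢-sym
  ; ~-irrefl = λ u≡v u≢v → u≢v u≡v
  }

infixr 2 _×ᴳ_

-- The direct (tensor) product.
_×ᴳ_ : Graph → Graph → Graph
G₁ ×ᴳ G₂ = record
  { Vertex   = G₁.Vertex × G₂.Vertex
  ; _~_      = λ (u₁ , u₂) (v₁ , v₂) → (u₁ G₁.~ v₁) × (u₂ G₂.~ v₂)
  ; ~-sym    = λ (p₁ , p₂) → G₁.~-sym p₁ , G₂.~-sym p₂
  ; ~-irrefl = λ { refl (p₁ , _) → G₁.~-irrefl refl p₁ }
  }
  where
  module G₁ = Graph G₁
  module G₂ = Graph G₂

module _ (G : Graph) where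
  open Graph G

  N[_] : Vertex → Pred Vertex 0ℓ
  N[ v ] w = w ≡ v ⊎ v ~ w

  -- A finite nonempty set of vertices, given by a list without repetitions,
  -- so that its cardinality is the length of the list.
  record Code : Set where
    field
      codewords : List Vertex
      unique    : Unique codewords
      nonempty  : codewords ≢ []

    ⟦_⟧ : Pred Vertex 0ℓ
    ⟦_⟧ v = v List.∈ codewords

    size : ℕ
    size = length codewords

  open Code using (⟦_⟧; size)

  I : Code → Vertex → Pred Vertex 0ℓ
  I C v = N[ v ] ∩ ⟦ C ⟧

  SelfLocatingDominating : Pred Code 0ℓ
  SelfLocatingDominating C =
    ∀ u → u ∉ ⟦ C ⟧ →
      Satisfiable (I C u) × ⋂ (∃ (I C u)) (λ (c , _) → N[ c ]) ≐ ｛ u ｝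

  -- The possible sizes of self-locating-dominating codes.
  SLDSize : Pred ℕ 0ℓ
  SLDSize k = ∃ λ C → SelfLocatingDominating C × size C ≡ k

Minimum : Pred ℕ 0ℓ → ℕ → Set
Minimum P k = k ∈ P × (∀ {j} → j ∈ P → k ≤ j)

infix 4 γˢˡᵈ_≔_

-- The minimum of a set of naturals cannot be computed without deciding
-- membership, so the equation γ^SLD(G) = k is expressed as a relation.
γˢˡᵈ_≔_ : Graph → ℕ → Set
γˢˡᵈ G ≔ k = Minimum (SLDSize G) k

γˢˡᵈ-unique : ∀ {G j k} → γˢˡᵈ G ≔ j → γˢˡᵈ G ≔ k → j ≡ k
γˢˡᵈ-unique (j∈ , j≤) (k∈ , k≤) = ≤-antisym (j≤ k∈) (k≤ j∈)

{-# OPTIONS --safe #-}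

-- View a code C in K n ×ᴳ K m as the edge set of a bipartite graph on the n
-- rows and m columns.  A vertex (i , j) outside C must be separated from each
-- (i , b) with b ≢ j, so the column b has a codeword off the row i, and
-- symmetrically for rows.  Hence an empty column forces all other columns to
-- be full, and a column with exactly one codeword (a , b) forces the row a to be
-- full.  If every column has two codewords, then |C| ≥ 2m.  Otherwise either all
-- columns but one (or all rows but one) are full, or some row is full and the
-- other rows are nonempty; for n > 2 each case gives |C| ≥ m + n - 1.
-- Equality is attained by the union of a row and a column.  For n = 2 < m a single
-- row suffices, and no column can be empty unless all others are full.
module Submission where

open import Defs
open import Data.Fin.Base using (Fin; zero; suc; opposite; punchIn)
open import Data.Fin.Patterns using (0F; 1F; 2F)
open import Data.Fin.Properties
  using (_≟_; any?; all?; injective⇒≤; punchIn-injective; punchInᵢ≢i;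
         ¬∀⟶∃¬; +↔⊎; *↔×; suc-injective)
open import Data.List.Base using (List; length; lookup; map; allFin; _++_; cartesianProduct)
open import Data.List.Membership.Propositional using (find; lose)
  renaming (_∈_ to _∈ˡ_)
open import Data.List.Membership.Propositional.Properties
  using (∈-map⁺; ∈-map⁻; ∈-++⁺ˡ; ∈-++⁺ʳ; ∈-allFin; ∈-cartesianProduct⁺)
import Data.List.Membership.DecPropositional as DecMembership
open import Data.List.Properties using (length-map; length-++; length-tabulate)
import Data.List.Relation.Unary.Any as Any
open import Data.List.Relation.Unary.Any.Properties using (lookup-index)
open import Data.List.Relation.Binary.Disjoint.Propositional using (Disjoint)
open import Data.List.Relation.Unary.Unique.Propositional using (Unique)
open import Data.List.Relation.Unary.Unique.Propositional.Properties
  using (map⁺; ++⁺; allFin⁺; cartesianProduct⁺)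
open import Data.Nat.Base using (ℕ; _+_; _*_; _∸_; _≤_; _≥_; _>_; zero; suc; z≤n; s≤s)
open import Data.Nat.Properties
  using (≤-trans; +-monoˡ-≤; +-monoʳ-≤; *-monoʳ-≤; *-comm; *-suc;
         +-identityʳ; +-suc; +-comm; m≤n⇒m≤1+n; module ≤-Reasoning)
open import Data.Product.Base using (∃; _×_; _,_; proj₁; proj₂)
open import Data.Product.Properties using (≡-dec; ,-injective)
open import Data.Sum.Base using (_⊎_; inj₁; inj₂)
open import Function.Base using (_∘_; id)
open import Function.Bundles using (_↔_; module Inverse)
open import Function.Construct.Identity using (↔-id)
open import Function.Definitions using (Injective)
open import Relation.Binary.Definitions using (Decidable; DecidableEquality)
open import Relation.Binary.PropositionalEquality
  using (_≡_; _≢_; refl; sym; trans; cong; cong₂; subst; ≢-sym; module ≡-Reasoning)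
open import Relation.Nullary
  using (yes; no; ¬_; ¬?; contradiction; _×-dec_; _⊎-dec_)
open import Relation.Nullary.Decidable using (decidable-stable)
open import Relation.Unary using (_∈_; _∉_; Satisfiable)

open Code using (codewords; ⟦_⟧; size)

-- Counting by injections, and a finite dichotomy.

-- Distinct values of `f` occupy distinct positions of the list. The source is any type in bijection
-- with `Fin k`, so that sums and products can be counted directly.
image-size : ∀ {k} {A B : Set} {xs : List B} → Fin k ↔ A → (f : A → B) →
             Injective _≡_ _≡_ f → (∀ a → f a ∈ˡ xs) → k ≤ length xs
image-size {xs = xs} k↔A f f-inj f∈ = injective⇒≤ {f = λ x → Any.index (f∈ (to x))} inj
  where
  open Inverse k↔A using (to; from; strictlyInverseʳ)
  inj : Injective _≡_ _≡_ (λ x → Any.index (f∈ (to x)))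
  inj {x} {y} eq = begin
    x            ≡⟨ strictlyInverseʳ x ⟨
    from (to x)  ≡⟨ cong from (f-inj same) ⟩
    from (to y)  ≡⟨ strictlyInverseʳ y ⟩
    y            ∎
    where
    open ≡-Reasoning
    same : f (to x) ≡ f (to y)
    same = begin
      f (to x)                                ≡⟨ lookup-index (f∈ (to x)) ⟩
      lookup xs (Any.index (f∈ (to x)))       ≡⟨ cong (lookup xs) eq ⟩
      lookup xs (Any.index (f∈ (to y)))       ≡⟨ lookup-index (f∈ (to y)) ⟨
      f (to y)                                ∎

third : ∀ {k} (x y : Fin (suc (suc (suc k)))) → ∃ λ z → z ≢ x × z ≢ y
third zero          zero          = 1F , (λ ()) , (λ ())
third zero          (suc zero)    = 2F , (λ ()) , (λ ())
third zero          (suc (suc _)) = 1F , (λ ()) , (λ ())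
third (suc zero)    zero          = 2F , (λ ()) , (λ ())
third (suc (suc _)) zero          = 1F , (λ ()) , (λ ())
third (suc _)       (suc _)       = 0F , (λ ()) , (λ ())

-- Finite search decides the alternative. It is applied to columns, to second codewords within
-- columns, and to rows.
total-or-empty : ∀ {p q} {R : Fin p → Fin q → Set} → Decidable R →
                 (∀ x → ∃ (R x)) ⊎ (∃ λ x → ∀ y → ¬ R x y)
total-or-empty {p} R? with all? (λ x → any? (R? x))
... | yes total = inj₁ total
... | no ¬total with x , ¬∃ ← ¬∀⟶∃¬ p _ (λ x → any? (R? x)) ¬total =
  inj₂ (x , λ y Rxy → ¬∃ (y , Rxy))

-- Self-location as pairwise separation.

module _ {G : Graph} (_≟ᵛ_ : DecidableEquality (Graph.Vertex G)) where

  open Graph G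

  -- Membership of `c` in the closed neighbourhood of `u` is reduced to adjacency, since `u` will be
  -- a non-codeword and so differs from `c`.
  Separated : Code G → Vertex → Vertex → Set
  Separated C u v = ∃ λ c → c ∈ ⟦ C ⟧ × u ~ c × v ∉ N[_] G c

  separated⇒SLD : (C : Code G) →
    (∀ {u} → u ∉ ⟦ C ⟧ → ∃ λ c → c ∈ ⟦ C ⟧ × u ~ c) →
    (∀ {u v} → u ∉ ⟦ C ⟧ → v ≢ u → Separated C u v) →
    SelfLocatingDominating G C
  separated⇒SLD C dom sep u u∉ = satisfiable , ⊆ , ⊇
    where
    satisfiable : Satisfiable (I G C u)
    satisfiable with c , c∈ , u~c ← dom u∉ = c , inj₂ u~c , c∈
    ⊆ : ∀ {v} → ((((c , _)) : ∃ (I G C u)) → v ∈ N[_] G c) → u ≡ v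
    ⊆ {v} v∈ with v ≟ᵛ u
    ... | yes v≡u = sym v≡u
    ... | no  v≢u with c , c∈ , u~c , v∉ ← sep u∉ v≢u =
      contradiction (v∈ (c , inj₂ u~c , c∈)) v∉
    ⊇ : ∀ {v} → u ≡ v → (((c , _)) : ∃ (I G C u)) → v ∈ N[_] G c
    ⊇ refl (c , inj₁ c≡u , _) = inj₁ (sym c≡u)
    ⊇ refl (c , inj₂ u~c , _) = inj₂ (~-sym u~c)

  -- The separating codeword is sought in the finite list of codewords. If the search fails, `v`
  -- lies in the closed neighbourhood of every element of `I C u`, and self-location gives `v ≡ u`.
  SLD⇒separated : Decidable _~_ → (C : Code G) → SelfLocatingDominating G C →
                  ∀ {u v} → u ∉ ⟦ C ⟧ → v ≢ u → Separated C u v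
  SLD⇒separated _~?_ C sld {u} {v} u∉ v≢u
    with Any.any? (λ c → (u ~? c) ×-dec ¬? ((v ≟ᵛ c) ⊎-dec (c ~? v))) (codewords C)
  ... | yes p with c , c∈ , u~c , v∉ ← find p = c , c∈ , u~c , v∉
  ... | no ¬p = contradiction (sym (proj₁ (proj₂ (sld u u∉)) v∈)) v≢u
    where
    v∈ : (((c , _)) : ∃ (I G C u)) → v ∈ N[_] G c
    v∈ (c , inj₁ refl , c∈) = contradiction c∈ u∉
    v∈ (c , inj₂ u~c , c∈) = decidable-stable ((v ≟ᵛ c) ⊎-dec (c ~? v))
      λ v∉ → ¬p (lose c∈ (u~c , v∉))

-- Row and column structure of the codes.

module _ {n m : ℕ} where

  _≟ᵛ_ : DecidableEquality (Fin n × Fin m)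
  _≟ᵛ_ = ≡-dec _≟_ _≟_

  open DecMembership _≟ᵛ_ public using (_∈?_)
  open Graph (K n ×ᴳ K m) using (_~_)

  _~?_ : Decidable _~_
  (a , b) ~? (i , j) = ¬? (a ≟ i) ×-dec ¬? (b ≟ j)

  same-row : ∀ {a b j} → b ≢ j → (a , b) ∉ N[_] (K n ×ᴳ K m) (a , j)
  same-row b≢j (inj₁ refl)      = b≢j refl
  same-row b≢j (inj₂ (a≢a , _)) = a≢a refl

  same-column : ∀ {a b i} → a ≢ i → (a , b) ∉ N[_] (K n ×ᴳ K m) (i , b)
  same-column a≢i (inj₁ refl)      = a≢i refl
  same-column a≢i (inj₂ (_ , b≢b)) = b≢b refl

module _ {n m : ℕ} (C : Code (K n ×ᴳ K m)) (sld : SelfLocatingDominating _ C) where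

  -- Distinct vertices are non-adjacent exactly when they share a row or a column. A codeword
  -- separating `(i , j)` from `(i , b)` is adjacent to the former, hence off row `i`, and so must
  -- share column `b` with the latter.
  codeword-in-column : ∀ {i j b} → (i , j) ∉ ⟦ C ⟧ → b ≢ j →
                       ∃ λ a → a ≢ i × (a , b) ∈ ⟦ C ⟧
  codeword-in-column {i} {j} {b} u∉ b≢j
    with (a , b′) , c∈ , (i≢a , _) , v∉ ←
      SLD⇒separated _≟ᵛ_ _~?_ C sld {v = i , b} u∉ (b≢j ∘ proj₂ ∘ ,-injective)
    with b′ ≟ b
  ... | yes refl = a , ≢-sym i≢a , c∈
  ... | no  b′≢b = contradiction (inj₂ (≢-sym i≢a , b′≢b)) v∉

  codeword-in-row : ∀ {i j a} → (i , j) ∉ ⟦ C ⟧ → a ≢ i →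
                    ∃ λ b → b ≢ j × (a , b) ∈ ⟦ C ⟧
  codeword-in-row {i} {j} {a} u∉ a≢i
    with (a′ , b) , c∈ , (_ , j≢b) , v∉ ←
      SLD⇒separated _≟ᵛ_ _~?_ C sld {v = a , j} u∉ (a≢i ∘ proj₁ ∘ ,-injective)
    with a′ ≟ a
  ... | yes refl = b , ≢-sym j≢b , c∈
  ... | no  a′≢a = contradiction (inj₂ (a′≢a , ≢-sym j≢b)) v∉

  -- A non-codeword `(i , j)` with `j ≢ b` would put a codeword into column `b`.
  empty-column⇒full : ∀ {b} → (∀ a → (a , b) ∉ ⟦ C ⟧) →
                      ∀ i {j} → j ≢ b → (i , j) ∈ ⟦ C ⟧
  empty-column⇒full empty i {j} j≢b = decidable-stable (_ ∈? codewords C)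
    λ u∉ → let a , _ , c∈ = codeword-in-column u∉ (≢-sym j≢b) in empty a c∈

  empty-row⇒full : ∀ {a} → (∀ b → (a , b) ∉ ⟦ C ⟧) →
                   ∀ {i} j → i ≢ a → (i , j) ∈ ⟦ C ⟧
  empty-row⇒full empty {i} j i≢a = decidable-stable (_ ∈? codewords C)
    λ u∉ → let b , _ , c∈ = codeword-in-row u∉ (≢-sym i≢a) in empty b c∈

  -- A gap in row `a` outside column `b` would require a codeword of column `b` in another row.
  lone-codeword⇒full-row : ∀ {a b} → (a , b) ∈ ⟦ C ⟧ → (∀ i → i ≢ a → (i , b) ∉ ⟦ C ⟧) →
                           ∀ j → (a , j) ∈ ⟦ C ⟧
  lone-codeword⇒full-row {a} {b} ab∈ lone j with b ≟ j
  ... | yes refl = ab∈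
  ... | no  b≢j  = decidable-stable (_ ∈? codewords C)
    λ u∉ → let i , i≢a , c∈ = codeword-in-column u∉ b≢j in lone i i≢a c∈

-- Counting codewords in full or nonempty rows and columns.

module _ {n′ m′ : ℕ} (C : Code (K (suc n′) ×ᴳ K (suc m′))) where

  private
    n m : ℕ
    n = suc n′
    m = suc m′

  full-off-column-size : ∀ b → (∀ i {j} → j ≢ b → (i , j) ∈ ⟦ C ⟧) → n * m′ ≤ size C
  full-off-column-size b full = image-size *↔× (λ (i , j) → i , punchIn b j)
    (λ eq → cong₂ _,_ (proj₁ (,-injective eq)) (punchIn-injective b _ _ (proj₂ (,-injective eq))))
    (λ (i , j) → full i (punchInᵢ≢i b j))

  full-off-row-size : ∀ a → (∀ {i} j → i ≢ a → (i , j) ∈ ⟦ C ⟧) → n′ * m ≤ size C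
  full-off-row-size a full = image-size *↔× (λ (i , j) → punchIn a i , j)
    (λ eq → cong₂ _,_ (punchIn-injective a _ _ (proj₁ (,-injective eq))) (proj₂ (,-injective eq)))
    (λ (i , j) → full j (punchInᵢ≢i a i))

  total-columns-size : (∀ b → ∃ λ a → (a , b) ∈ ⟦ C ⟧) → m ≤ size C
  total-columns-size total = image-size (↔-id (Fin m)) (λ b → proj₁ (total b) , b)
    (proj₂ ∘ ,-injective) (proj₂ ∘ total)

  -- The two codewords chosen in one column differ in their rows, and those of different columns
  -- differ in their columns, so no codeword is counted twice.
  two-per-column-size : (f : ∀ b → ∃ λ a → (a , b) ∈ ⟦ C ⟧) →
    (∀ b → ∃ λ a → a ≢ proj₁ (f b) × (a , b) ∈ ⟦ C ⟧) → m + m ≤ size C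
  two-per-column-size f g = image-size +↔⊎ h h-inj h∈
    where
    h : Fin m ⊎ Fin m → Fin n × Fin m
    h (inj₁ b) = proj₁ (f b) , b
    h (inj₂ b) = proj₁ (g b) , b
    h-inj : Injective _≡_ _≡_ h
    h-inj {inj₁ b} {inj₁ _} eq = cong inj₁ (proj₂ (,-injective eq))
    h-inj {inj₂ b} {inj₂ _} eq = cong inj₂ (proj₂ (,-injective eq))
    h-inj {inj₁ b} {inj₂ _} eq with ,-injective eq
    ... | p , refl = contradiction (sym p) (proj₁ (proj₂ (g b)))
    h-inj {inj₂ b} {inj₁ _} eq with ,-injective eq
    ... | p , refl = contradiction p (proj₁ (proj₂ (g b)))
    h∈ : ∀ x → h x ∈ ⟦ C ⟧
    h∈ (inj₁ b) = proj₂ (f b)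
    h∈ (inj₂ b) = proj₂ (proj₂ (g b))

  -- Row `a` contributes `m` codewords, and one more is picked from each of the other rows, which
  -- `punchIn a` enumerates.
  full-row-size : ∀ {a} → (∀ j → (a , j) ∈ ⟦ C ⟧) →
                  (∀ i → ∃ λ j → (i , j) ∈ ⟦ C ⟧) → m + n′ ≤ size C
  full-row-size {a} full f = image-size +↔⊎ h h-inj h∈
    where
    h : Fin m ⊎ Fin n′ → Fin n × Fin m
    h (inj₁ j) = a , j
    h (inj₂ i) = punchIn a i , proj₁ (f (punchIn a i))
    h-inj : Injective _≡_ _≡_ h
    h-inj {inj₁ j} {inj₁ _} eq = cong inj₁ (proj₂ (,-injective eq))
    h-inj {inj₂ i} {inj₂ _} eq = cong inj₂ (punchIn-injective a _ _ (proj₁ (,-injective eq)))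
    h-inj {inj₁ j} {inj₂ i} eq = contradiction (sym (proj₁ (,-injective eq))) (punchInᵢ≢i a i)
    h-inj {inj₂ i} {inj₁ j} eq = contradiction (proj₁ (,-injective eq)) (punchInᵢ≢i a i)
    h∈ : ∀ x → h x ∈ ⟦ C ⟧
    h∈ (inj₁ j) = full j
    h∈ (inj₂ i) = proj₂ (f (punchIn a i))

-- Lower bounds for `n > 2` and for `n = 2`.

1+a≤a*b : ∀ {a b} → 1 ≤ a → 2 ≤ b → suc a ≤ a * b
1+a≤a*b {a} {b} 1≤a 2≤b = begin
  1 + a        ≤⟨ +-monoˡ-≤ a 1≤a ⟩
  a + a        ≡⟨ cong (a +_) (+-identityʳ a) ⟨
  2 * a        ≡⟨ *-comm 2 a ⟩
  a * 2        ≤⟨ *-monoʳ-≤ a 2≤b ⟩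
  a * b        ∎
  where open ≤-Reasoning

size-lower-bound : ∀ {n′ m′} → 2 ≤ n′ → n′ ≤ m′ → (C : Code (K (suc n′) ×ᴳ K (suc m′))) →
                   SelfLocatingDominating _ C → suc m′ + n′ ≤ size C
size-lower-bound {n′} {m′} 2≤n′ n′≤m′ C sld
  with total-or-empty (λ b a → (a , b) ∈? codewords C)
... | inj₂ (b , empty) = begin
  suc m′ + n′      ≡⟨ +-suc m′ n′ ⟨
  -- `suc n′ * m′` unfolds to `m′ + n′ * m′`, which leaves `suc n′ ≤ n′ * m′`.
  m′ + suc n′      ≤⟨ +-monoʳ-≤ m′ (1+a≤a*b (≤-trans (s≤s z≤n) 2≤n′) (≤-trans 2≤n′ n′≤m′)) ⟩
  suc n′ * m′      ≤⟨ full-off-column-size C b (empty-column⇒full C sld empty) ⟩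
  size C           ∎
  where open ≤-Reasoning
... | inj₁ f
  with total-or-empty (λ b a → ¬? (a ≟ proj₁ (f b)) ×-dec ((a , b) ∈? codewords C))
... | inj₁ g = ≤-trans (+-monoʳ-≤ (suc m′) (m≤n⇒m≤1+n n′≤m′)) (two-per-column-size C f g)
... | inj₂ (b , lone)
  with total-or-empty (λ a b → (a , b) ∈? codewords C)
... | inj₁ g = full-row-size C
  (lone-codeword⇒full-row C sld (proj₂ (f b)) (λ i i≢a ib∈ → lone i (i≢a , ib∈))) g
-- A single full row beside an empty one is what makes `n = 2` cheaper. Here `2 ≤ n′` provides at
-- least two full rows.
... | inj₂ (a , empty) = begin
  suc m′ + n′      ≡⟨ +-comm (suc m′) n′ ⟩
  n′ + suc m′      ≤⟨ +-monoʳ-≤ n′ (1+a≤a*b (≤-trans (s≤s z≤n) (≤-trans 2≤n′ n′≤m′)) 2≤n′) ⟩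
  n′ + m′ * n′     ≡⟨ cong (n′ +_) (*-comm m′ n′) ⟩
  n′ + n′ * m′     ≡⟨ *-suc n′ m′ ⟨
  n′ * suc m′      ≤⟨ full-off-row-size C a (empty-row⇒full C sld empty) ⟩
  size C           ∎
  where open ≤-Reasoning

-- Without an empty column, one codeword per column is enough. An empty column forces `2 * m′`
-- codewords, at least `suc m′` because `1 ≤ m′`.
size-lower-bound₂ : ∀ {m′} → 1 ≤ m′ → (C : Code (K 2 ×ᴳ K (suc m′))) →
                    SelfLocatingDominating _ C → suc m′ ≤ size C
size-lower-bound₂ {m′} 1≤m′ C sld
  with total-or-empty (λ b a → (a , b) ∈? codewords C)
... | inj₁ f = total-columns-size C f
... | inj₂ (b , empty) = begin
  1 + m′           ≤⟨ +-monoˡ-≤ m′ 1≤m′ ⟩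
  m′ + m′          ≡⟨ cong (m′ +_) (+-identityʳ m′) ⟨
  2 * m′           ≤⟨ full-off-column-size C b (empty-column⇒full C sld empty) ⟩
  size C           ∎
  where open ≤-Reasoning

-- The case `n = m = 2`.

opposite-≢ : (i : Fin 2) → opposite i ≢ i
opposite-≢ 0F ()
opposite-≢ 1F ()

≢⇒≡opposite : {i j : Fin 2} → i ≢ j → opposite i ≡ j
≢⇒≡opposite {0F} {0F} i≢j = contradiction refl i≢j
≢⇒≡opposite {0F} {1F} _   = refl
≢⇒≡opposite {1F} {0F} _   = refl
≢⇒≡opposite {1F} {1F} i≢j = contradiction refl i≢j

-- K 2 ×ᴳ K 2 is a perfect matching, in which the ends of an edge have the same
-- closed neighbourhood and so cannot be separated.
SLD⇒full₂₂ : (C : Code (K 2 ×ᴳ K 2)) → SelfLocatingDominating _ C → ∀ u → u ∈ ⟦ C ⟧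
SLD⇒full₂₂ C sld (i , j) = decidable-stable (_ ∈? codewords C) λ u∉ →
  let c , _ , (i≢a , j≢b) , v∉ = SLD⇒separated _≟ᵛ_ _~?_ C sld {v = opposite i , opposite j} u∉
                                   (opposite-≢ i ∘ proj₁ ∘ ,-injective)
  in v∉ (inj₁ (cong₂ _,_ (≢⇒≡opposite i≢a) (≢⇒≡opposite j≢b)))

-- Codes attaining the bounds.

row : ∀ n m → List (Fin (suc n) × Fin m)
row n m = map (0F ,_) (allFin m)

-- Starting at `suc i` leaves the corner `(0F , 0F)` to `row` alone, so that the two lists are
-- disjoint and their lengths add up.
column : ∀ n m → List (Fin (suc n) × Fin (suc m))
column n m = map (λ i → suc i , 0F) (allFin n)

row-length : ∀ n m → length (row n m) ≡ m
row-length n m = trans (length-map _ (allFin m)) (length-tabulate {n = m} id)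

column-length : ∀ n m → length (column n m) ≡ n
column-length n m = trans (length-map _ (allFin n)) (length-tabulate {n = n} id)

row-unique : ∀ n m → Unique (row n m)
row-unique n m = map⁺ (proj₂ ∘ ,-injective) (allFin⁺ m)

column-unique : ∀ n m → Unique (column n m)
column-unique n m = map⁺ (suc-injective ∘ proj₁ ∘ ,-injective) (allFin⁺ n)

row-column-disjoint : ∀ n m → Disjoint (row n (suc m)) (column n m)
row-column-disjoint n m (v∈row , v∈column) with ∈-map⁻ _ v∈row | ∈-map⁻ _ v∈column
... | _ , _ , refl | _ , _ , ()

module _ (k : ℕ) where

  private
    m : ℕ
    m = suc (suc (suc k))

  row-code : Code (K 2 ×ᴳ K m)
  row-code = record
    { codewords = row 1 m
    ; unique    = row-unique 1 m
    ; nonempty  = λ ()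
    }

  row-code-SLD : SelfLocatingDominating _ row-code
  row-code-SLD = separated⇒SLD _≟ᵛ_ row-code dom sep
    where
    row∈ : ∀ j → (0F , j) ∈ ⟦ row-code ⟧
    row∈ j = ∈-map⁺ (0F ,_) (∈-allFin j)
    open Graph (K 2 ×ᴳ K m) using (_~_)
    dom : ∀ {u} → u ∉ ⟦ row-code ⟧ → ∃ λ c → c ∈ ⟦ row-code ⟧ × u ~ c
    dom {0F , j} u∉ = contradiction (row∈ j) u∉
    dom {1F , j} u∉ with b , b≢j , _ ← third j j = (0F , b) , row∈ b , (λ ()) , ≢-sym b≢j
    sep : ∀ {u v} → u ∉ ⟦ row-code ⟧ → v ≢ u → Separated _≟ᵛ_ row-code u v
    sep {0F , j} u∉ _ = contradiction (row∈ j) u∉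
    -- `(0F , l)` is itself a codeword, and only the other codewords of its row miss it. The one
    -- chosen must avoid both columns `j` and `l`, which is possible because `m > 2`.
    sep {1F , j} {0F , l} u∉ v≢u with b , b≢j , b≢l ← third j l =
      (0F , b) , row∈ b , ((λ ()) , ≢-sym b≢j) , same-row (≢-sym b≢l)
    sep {1F , j} {1F , l} u∉ v≢u =
      (0F , l) , row∈ l , ((λ ()) , λ j≡l → v≢u (cong (1F ,_) (sym j≡l))) , same-column (λ ())

module _ (n′ k : ℕ) where

  private
    n m : ℕ
    n = suc n′
    m = suc (suc (suc k))

  cross-code : Code (K n ×ᴳ K m)
  cross-code = record
    { codewords = row n′ m ++ column n′ _
    ; unique    = ++⁺ (row-unique n′ m) (column-unique n′ _) (row-column-disjoint n′ _)
    ; nonempty  = λ ()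
    }

  cross-code-size : size cross-code ≡ m + n′
  cross-code-size = trans (length-++ (row n′ m))
    (cong₂ _+_ (row-length n′ m) (column-length n′ (suc (suc k))))

  -- A vertex `u` off the cross has both coordinates nonzero. Each separating codeword differs from
  -- `v` but shares its row or column, while avoiding the row and the column of `u`.
  cross-code-SLD : SelfLocatingDominating _ cross-code
  cross-code-SLD = separated⇒SLD _≟ᵛ_ cross-code dom sep
    where
    open Graph (K n ×ᴳ K m) using (_~_)
    row∈ : ∀ j → (0F , j) ∈ ⟦ cross-code ⟧
    row∈ j = ∈-++⁺ˡ (∈-map⁺ (0F ,_) (∈-allFin j))
    column∈ : ∀ i → (suc i , 0F) ∈ ⟦ cross-code ⟧
    column∈ i = ∈-++⁺ʳ (row n′ m) (∈-map⁺ _ (∈-allFin i))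
    dom : ∀ {u} → u ∉ ⟦ cross-code ⟧ → ∃ λ c → c ∈ ⟦ cross-code ⟧ × u ~ c
    dom {zero  , j}     u∉ = contradiction (row∈ j) u∉
    dom {suc i , zero}  u∉ = contradiction (column∈ i) u∉
    dom {suc _ , suc _} u∉ = (0F , 0F) , row∈ 0F , (λ ()) , (λ ())
    sep : ∀ {u v} → u ∉ ⟦ cross-code ⟧ → v ≢ u → Separated _≟ᵛ_ cross-code u v
    sep {zero  , j}     u∉ _ = contradiction (row∈ j) u∉
    sep {suc i , zero}  u∉ _ = contradiction (column∈ i) u∉
    -- The corner cannot separate itself from `u`, so a third column is needed, different from `0F`
    -- and from that of `u`.
    sep {suc _ , suc j} {zero , zero} _ _ with b , b≢j , b≢0 ← third (suc j) 0F =
      (0F , b) , row∈ b , ((λ ()) , ≢-sym b≢j) , same-row (≢-sym b≢0)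
    sep {suc _ , suc _} {zero , suc _} _ _ =
      (0F , 0F) , row∈ 0F , ((λ ()) , (λ ())) , same-row (λ ())
    sep {suc _ , suc _} {suc _ , zero} _ _ =
      (0F , 0F) , row∈ 0F , ((λ ()) , (λ ())) , same-column (λ ())
    -- If the columns differ, the projection of `v` to row `0F` separates. Otherwise the rows
    -- differ, and its projection to column `0F` does.
    sep {suc i , suc j} {suc a , suc b} _ v≢u with j ≟ b
    ... | no  j≢b  = (0F , suc b) , row∈ (suc b) ,
                     ((λ ()) , j≢b ∘ suc-injective) , same-column (λ ())
    ... | yes refl = (suc a , 0F) , column∈ a ,
                     ((λ { refl → v≢u refl }) , (λ ())) , same-row (λ ())

full-code : ∀ n m → Code (K (suc n) ×ᴳ K (suc m))
full-code n m = record
  { codewords = cartesianProduct (allFin (suc n)) (allFin (suc m))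
  ; unique    = cartesianProduct⁺ (allFin⁺ (suc n)) (allFin⁺ (suc m))
  ; nonempty  = λ ()
  }

-- Vacuous, since every vertex is a codeword.
full-code-SLD : ∀ n m → SelfLocatingDominating _ (full-code n m)
full-code-SLD n m (i , j) u∉ =
  contradiction (∈-cartesianProduct⁺ (∈-allFin i) (∈-allFin j)) u∉

theorem19 : (m n : ℕ) → m ≥ n → n ≥ 2 →
    (n > 2 → γˢˡᵈ (K n ×ᴳ K m) ≔ (m + n ∸ 1)) ×
    (n ≡ 2 → m > 2 → γˢˡᵈ (K n ×ᴳ K m) ≔ m) ×
    (n ≡ 2 → m ≡ 2 → γˢˡᵈ (K n ×ᴳ K m) ≔ 4)
theorem19 m n m≥n n≥2 = large m≥n , two-rows , two-by-two
  where
  large : ∀ {m n} → m ≥ n → n > 2 → γˢˡᵈ (K n ×ᴳ K m) ≔ (m + n ∸ 1)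
  large {suc m′@(suc (suc k))} {suc n′} (s≤s n′≤m′) (s≤s 2≤n′) =
    -- `m + n ∸ 1` reduces to `m′ + suc n′`, whereas the code size and the lower bound have the form
    -- `suc m′ + n′`.
    subst (γˢˡᵈ K (suc n′) ×ᴳ K (suc m′) ≔_) (sym (+-suc m′ n′))
      ( (cross-code n′ k , cross-code-SLD n′ k , cross-code-size n′ k)
      , λ { (C , sld , refl) → size-lower-bound 2≤n′ n′≤m′ C sld })
  large {suc zero}       (s≤s z≤n)       (s≤s ())
  large {suc (suc zero)} (s≤s (s≤s z≤n)) (s≤s (s≤s ()))

  two-rows : ∀ {m n} → n ≡ 2 → m > 2 → γˢˡᵈ (K n ×ᴳ K m) ≔ m
  two-rows {suc (suc (suc k))} refl _ =
      (row-code k , row-code-SLD k , row-length 1 _)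
    , λ { (C , sld , refl) → size-lower-bound₂ (s≤s z≤n) C sld }
  two-rows {suc zero}       refl (s≤s ())
  two-rows {suc (suc zero)} refl (s≤s (s≤s ()))

  two-by-two : ∀ {m n} → n ≡ 2 → m ≡ 2 → γˢˡᵈ (K n ×ᴳ K m) ≔ 4
  two-by-two refl refl =
      (full-code 1 1 , full-code-SLD 1 1 , refl)
    -- All four vertices are codewords, counted through the bijection of `Fin (2 * 2)` with
    -- `Fin 2 × Fin 2`.
    , λ { (C , sld , refl) → image-size (*↔× {2} {2}) id id (SLD⇒full₂₂ C sld) }
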